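{- For all integers $m,n$ with $1\le m\le n$, $R(c(nK_3),mK_2)=3n+m-1$.
   Context: $mK_2$ denotes a matching of $m$ pairwise vertex-disjoint edges. $c(nK_3)$ (a connected triangle matching) denotes any connected graph containing $n$ pairwise vertex-disjoint triangles. $R(c(nK_3),mK_2)$ denotes the smallest positive integer $N$ such that in every coloring of the edges of the complete graph $K_N$ with two colors (red and blue), either the graph of red edges contains as a subgraph some connected graph containing $n$ pairwise vertex-disjoint triangles (equivalently, some connected component of the red graph contains $n$ pairwise vertex-disjoint triangles), or the graph of blue edges contains $m$ pairwise vertex-disjoint edges. -}

module Defs where

open import Data.Fin using (Fin)
open import Data.Nat using (ℕ; _<_; _≤_)
open import Data.Product using (_×_; _,_; ∃-syntax)
open import Data.Sum using (_⊎_)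
open import Function.Definitions using (Injective)
open import Level using (0ℓ)
open import Relation.Binary.Construct.Closure.ReflexiveTransitive using (Star)
open import Relation.Binary.Core using (Rel)
open import Relation.Binary.Definitions using (Symmetric; Irreflexive)
open import Relation.Binary.PropositionalEquality using (_≡_; _≢_; refl; sym; trans; ≢-sym)

record Graph (V : Set) : Set₁ where
  field
    Adj    : Rel V 0ℓ
    symm   : Symmetric Adj
    irrefl : Irreflexive _≡_ Adj

open Graph public

Connected : {V : Set} → Graph V → Set
Connected G = ∀ u v → Star (Adj G) u v

infix 4 _⊑_

-- H ⊑ G : G contains a (not necessarily induced) copy of H.
record _⊑_ {W V : Set} (H : Graph W) (G : Graph V) : Set where
  field
    to        : W → V
    injective : Injective _≡_ _≡_ to
    preserves : ∀ {u v} → Adj H u v → Adj G (to u) (to v)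

K : (n : ℕ) → Graph (Fin n)
K n = record
  { Adj    = _≢_
  ; symm   = ≢-sym
  ; irrefl = λ u≡v u≢v → u≢v u≡v
  }

infixr 7 _·_

-- n · G is the union of n pairwise vertex-disjoint copies of G.
_·_ : {V : Set} (n : ℕ) → Graph V → Graph (Fin n × V)
n · G = record
  { Adj    = λ { (i , u) (j , v) → i ≡ j × Adj G u v }
  ; symm   = λ { (i≡j , uv) → sym i≡j , symm G uv }
  ; irrefl = λ { refl (_ , uu) → irrefl G refl uu }
  }

Family : Set₁
Family = ∀ {k} → Graph (Fin k) → Set

c : {W : Set} → Graph W → Family
c H G = Connected G × H ⊑ G

data Colour : Set where
  red blue : Colour

-- A colouring of the edges of K N.  The values colour u u carry no meaning
-- and are ignored by colourClass.
record Colouring (N : ℕ) : Set where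
  field
    colour      : Fin N → Fin N → Colour
    colour-symm : ∀ u v → colour u v ≡ colour v u

open Colouring public

colourClass : {N : ℕ} → Colouring N → Colour → Graph (Fin N)
colourClass χ x = record
  { Adj    = λ u v → u ≢ v × colour χ u v ≡ x
  ; symm   = λ { {u} {v} (u≢v , eq) → ≢-sym u≢v , trans (colour-symm χ v u) eq }
  ; irrefl = λ { u≡v (u≢v , _) → u≢v u≡v }
  }

Arrows : {W : Set} → ℕ → Family → Graph W → Set₁
Arrows N 𝒢 H =
  (χ : Colouring N) →
    (∃[ k ] ∃[ G ] (𝒢 {k} G × G ⊑ colourClass χ red))
    ⊎ H ⊑ colourClass χ blue

-- IsRamseyNumber 𝒢 H N : R(𝒢, H) = N.
IsRamseyNumber : {W : Set} → Family → Graph W → ℕ → Set₁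
IsRamseyNumber 𝒢 H N =
  0 < N × Arrows N 𝒢 H × (∀ M → 0 < M → Arrows M 𝒢 H → N ≤ M)

{-# OPTIONS --safe #-}

-- Lower bound: colour red exactly the pairs inside a set of 3n − 1 vertices; the
-- remaining m − 1 vertices meet every blue edge.
--
-- Upper bound: take a blue matching admitting neither an extension nor an
-- augmenting path of length 3, of size k < m say, and let U be its set of
-- unmatched vertices.  Then U is a red clique, and every matching edge has an
-- endpoint z that is red to all of U except perhaps one vertex.  As m ≤ n, U
-- is large enough to complete each such z to a red triangle with two vertices of
-- U, all disjoint.  The rest of U is cut into triangles, and this uses
-- |U| + k = N − k ≥ 3n vertices.  Every triangle meets the clique U, so all lie
-- in one red component.

module Submission where

open import Defs
open import Data.Nat using (ℕ; zero; suc; _+_; _*_; _∸_; _≤_; _<_; s≤s; z≤n; _<?_)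
open import Data.Nat.Properties
open import Data.Nat.Solver using (module +-*-Solver)
open import Data.Fin using (Fin; zero; suc; toℕ; fromℕ<; combine; remQuot)
open import Data.Fin.Properties as Fin
  using (toℕ<n; fromℕ<-injective; toℕ-injective; injective⇒≤;
         remQuot-combine; combine-remQuot; combine-injective)
open import Data.Product using (_×_; _,_; ∃₂; ∃-syntax; proj₁; proj₂; uncurry)
open import Data.Product.Properties using (≡-dec)
open import Data.Sum using (_⊎_; inj₁; inj₂)
open import Data.List using (List; []; _∷_; _++_; length; concatMap; lookup; allFin)
open import Data.List.Properties using (length-++; length-tabulate; ++-assoc)
open import Data.List.Membership.Propositional using (_∈_)
open import Data.List.Membership.Propositional.Properties using (∈-lookup)
open import Data.List.Relation.Unary.All as All using (All; []; _∷_)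
open import Data.List.Relation.Unary.All.Properties using (++⁻; ++⁻ˡ; ++⁻ʳ)
open import Data.List.Relation.Unary.Any using (here; there)
open import Data.List.Relation.Unary.AllPairs using (AllPairs; []; _∷_)
open import Data.List.Relation.Unary.Unique.Propositional using (Unique)
open import Data.List.Relation.Unary.Unique.Propositional.Properties using (allFin⁺)
open import Data.List.Relation.Binary.Permutation.Propositional
open import Data.List.Relation.Binary.Permutation.Propositional.Properties
  using (All-resp-↭; ↭-length; ++⁺ˡ; ++⁺ʳ; shift; shifts; ++-comm)
import Data.List.Relation.Binary.Permutation.Setoid.Properties as Permutationₛ
open import Data.Vec as Vec using (Vec; []; _∷_; toList)
open import Function using (_∘_)
open import Function.Definitions using (Injective)
open import Relation.Binary.Construct.Closure.ReflexiveTransitive using (Star; ε; _◅_; _◅◅_)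
open import Relation.Binary.Core using (Rel)
open import Relation.Binary.Definitions using (Symmetric)
open import Relation.Binary.PropositionalEquality as ≡
  using (_≡_; _≢_; refl; sym; cong; cong₂; subst; ≢-sym; setoid)
open import Relation.Nullary using (¬_; yes; no; contradiction)
open import Relation.Nullary.Decidable using (decidable-stable)
open import Level using (0ℓ)

open _⊑_

private
  variable
    A : Set
    k : ℕ
    R : Rel A 0ℓ
    P Q : A → Set

-- Lists up to permutation: pairwise relations and extraction of elements.

Unique-resp-↭ : {xs ys : List A} → xs ↭ ys → Unique xs → Unique ys
Unique-resp-↭ p = Permutationₛ.Unique-resp-↭ (setoid _) (↭⇒↭ₛ p)

AllPairs-++⁻ : ∀ xs {ys} → AllPairs R (xs ++ ys) →
               AllPairs R xs × All (λ x → All (R x) ys) xs × AllPairs R ys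
AllPairs-++⁻ []       rs       = [] , [] , rs
AllPairs-++⁻ (x ∷ xs) (r ∷ rs) with ++⁻ xs r | AllPairs-++⁻ xs rs
... | r₁ , r₂ | rs₁ , c , rs₂ = r₁ ∷ rs₁ , r₂ ∷ c , rs₂

AllPairs-∈ : ∀ {xs x y} → Symmetric R → AllPairs R xs → x ∈ xs → y ∈ xs → x ≢ y → R x y
AllPairs-∈ s (r ∷ rs) (here refl) (here refl) x≢y = contradiction refl x≢y
AllPairs-∈ s (r ∷ rs) (here refl) (there y∈)  x≢y = All.lookup r y∈
AllPairs-∈ s (r ∷ rs) (there x∈)  (here refl) x≢y = s (All.lookup r x∈)
AllPairs-∈ s (r ∷ rs) (there x∈)  (there y∈)  x≢y = AllPairs-∈ s rs x∈ y∈ x≢y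

-- The choice `d` takes the place of deciding `P`, so a failed search yields positive data: with
-- blue and red for `P` and `Q`, finding no blue edge gives red ones directly.
extract : (∀ x → P x ⊎ Q x) → (xs : List A) →
          (∃₂ λ x ys → xs ↭ x ∷ ys × P x) ⊎ All Q xs
extract d []       = inj₂ []
extract d (x ∷ xs) with d x
... | inj₁ px = inj₁ (x , xs , ↭-refl , px)
... | inj₂ qx with extract d xs
... | inj₁ (y , ys , p , py) = inj₁ (y , x ∷ ys , ↭-trans (prep x p) (swap x y ↭-refl) , py)
... | inj₂ qxs = inj₂ (qx ∷ qxs)

extractPair : {S : Rel A 0ℓ} → (∀ x y → R x y ⊎ S x y) → (xs : List A) →
              (∃[ x ] ∃[ y ] ∃[ ys ] (xs ↭ x ∷ y ∷ ys × R x y)) ⊎ AllPairs S xs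
extractPair d []       = inj₂ []
extractPair d (x ∷ xs) with extract (d x) xs
... | inj₁ (y , ys , p , r) = inj₁ (x , y , ys , prep x p , r)
... | inj₂ ss with extractPair d xs
... | inj₁ (y , z , ys , p , r) =
  inj₁ (y , z , x ∷ ys ,
        ↭-trans (prep x p) (↭-trans (swap x y ↭-refl) (prep y (swap x z ↭-refl))) , r)
... | inj₂ sss = inj₂ (ss ∷ sss)

-- The exception is a single fixed value, so among distinct entries at most one escapes `Q`. It may
-- also lie outside the list, and then all entries satisfy `Q`.
AllBut : (A → Set) → A → A → Set
AllBut Q e x = x ≡ e ⊎ Q x

-- At most one of three distinct entries equals the exception `e`, which leaves two that satisfy
-- `Q`.
extractTwo : ∀ {e a b d : A} {xs} → Unique (a ∷ b ∷ d ∷ xs) →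
             All (AllBut Q e) (a ∷ b ∷ d ∷ xs) →
             ∃[ x ] ∃[ y ] ∃[ ys ] (a ∷ b ∷ d ∷ xs ↭ x ∷ y ∷ ys × Q x × Q y)
extractTwo _ (inj₂ qa ∷ inj₂ qb ∷ _) = _ , _ , _ , ↭-refl , qa , qb
extractTwo _ (inj₂ qa ∷ inj₁ _ ∷ inj₂ qd ∷ _) =
  _ , _ , _ , prep _ (swap _ _ ↭-refl) , qa , qd
extractTwo _ (inj₁ _ ∷ inj₂ qb ∷ inj₂ qd ∷ _) =
  _ , _ , _ , ↭-trans (swap _ _ ↭-refl) (prep _ (swap _ _ ↭-refl)) , qb , qd
extractTwo ((a≢b ∷ _) ∷ _) (inj₁ refl ∷ inj₁ refl ∷ _) = contradiction refl a≢b
extractTwo ((_ ∷ a≢d ∷ _) ∷ _) (inj₁ refl ∷ _ ∷ inj₁ refl ∷ _) = contradiction refl a≢d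
extractTwo (_ ∷ (b≢d ∷ _) ∷ _) (_ ∷ inj₁ refl ∷ inj₁ refl ∷ _) = contradiction refl b≢d

-- Lists of blocks and their entries, indexed by block and position.

flatten : List (Vec A k) → List A
flatten = concatMap toList

flatten-↭ : {bs cs : List (Vec A k)} → bs ↭ cs → flatten bs ↭ flatten cs
flatten-↭ refl = ↭-refl
flatten-↭ (prep b p) = ++⁺ˡ (toList b) (flatten-↭ p)
flatten-↭ {cs = _ ∷ _ ∷ cs} (swap b c p) = ↭-trans
  (++⁺ˡ (toList b) (++⁺ˡ (toList c) (flatten-↭ p)))
  (shifts (toList b) (toList c))
flatten-↭ (trans p q) = ↭-trans (flatten-↭ p) (flatten-↭ q)

length-flatten : (bs : List (Vec A 2)) → length (flatten bs) ≡ 2 * length bs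
length-flatten []                 = refl
length-flatten ((x ∷ y ∷ []) ∷ bs) =
  ≡.trans (cong (2 +_) (length-flatten bs)) (sym (*-suc 2 (length bs)))

entry : (bs : List (Vec A k)) → Fin (length bs) × Fin k → A
entry bs (i , j) = Vec.lookup (lookup bs i) j

All-vec : (b : Vec A k) → All P (toList b) → ∀ j → P (Vec.lookup b j)
All-vec (x ∷ b) (p ∷ ps) zero    = p
All-vec (x ∷ b) (p ∷ ps) (suc j) = All-vec b ps j

All-entry : (bs : List (Vec A k)) → All P (flatten bs) → ∀ p → P (entry bs p)
All-entry (b ∷ bs) ps (zero  , j) = All-vec b (++⁻ˡ (toList b) ps) j
All-entry (b ∷ bs) ps (suc i , j) = All-entry bs (++⁻ʳ (toList b) ps) (i , j)

AllPairs-vec : Symmetric R → (b : Vec A k) → AllPairs R (toList b) →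
               ∀ {i j} → i ≢ j → R (Vec.lookup b i) (Vec.lookup b j)
AllPairs-vec s (x ∷ b) (r ∷ rs) {zero}  {zero}  i≢j = contradiction refl i≢j
AllPairs-vec s (x ∷ b) (r ∷ rs) {zero}  {suc j} i≢j = All-vec b r j
AllPairs-vec s (x ∷ b) (r ∷ rs) {suc i} {zero}  i≢j = s (All-vec b r i)
AllPairs-vec s (x ∷ b) (r ∷ rs) {suc i} {suc j} i≢j = AllPairs-vec s b rs (i≢j ∘ cong suc)

AllPairs-entry : Symmetric R → (bs : List (Vec A k)) → AllPairs R (flatten bs) →
                 ∀ {p q} → p ≢ q → R (entry bs p) (entry bs q)
AllPairs-entry s (b ∷ bs) rs {i , j} {i′ , j′} p≢q with AllPairs-++⁻ (toList b) rs
AllPairs-entry s (b ∷ bs) rs {zero  , j} {zero   , j′} p≢q | r , _ , _ =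
  AllPairs-vec s b r (p≢q ∘ cong (zero ,_))
AllPairs-entry s (b ∷ bs) rs {zero  , j} {suc i′ , j′} p≢q | _ , c , _ =
  All-entry bs (All-vec b c j) (i′ , j′)
AllPairs-entry s (b ∷ bs) rs {suc i , j} {zero   , j′} p≢q | _ , c , _ =
  s (All-entry bs (All-vec b c j′) (i , j))
AllPairs-entry s (b ∷ bs) rs {suc i , j} {suc i′ , j′} p≢q | _ , _ , t =
  AllPairs-entry s bs t {i , j} {i′ , j′} λ { refl → p≢q refl }

-- `AllPairs-entry` for the relation `_≢_` only excludes that distinct positions carry equal
-- entries; decidable equality of positions removes the double negation.
entry-injective : (bs : List (Vec A k)) → Unique (flatten bs) → Injective _≡_ _≡_ (entry bs)
entry-injective bs u {p} {q} eq =
  decidable-stable (≡-dec Fin._≟_ Fin._≟_ p q) λ p≢q → AllPairs-entry ≢-sym bs u p≢q eq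

-- A connected graph from disjoint cliques with adjacent hubs.

connectedCopy : {V : Set} {G : Graph V} {n : ℕ} (H : n · K (suc k) ⊑ G) →
                (∀ {i i′} → i ≢ i′ → Adj G (to H (i , zero)) (to H (i′ , zero))) →
                ∃[ l ] ∃[ G′ ] (c (n · K (suc k)) {l} G′ × G′ ⊑ G)
connectedCopy {k = k} {G = G} {n} H hub = n * suc k , G′ , (conn , into) , out
  where
  f : Fin (n * suc k) → Fin n × Fin (suc k)
  f = remQuot (suc k)

  f-injective : Injective _≡_ _≡_ f
  f-injective {x} {y} eq = ≡.trans (sym (combine-remQuot {n} (suc k) x))
    (≡.trans (cong (uncurry combine) eq) (combine-remQuot {n} (suc k) y))

  -- All edges of `G` among the copied vertices are kept, not just those inside the copies: the
  -- edges between hubs are what connects the graph.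
  G′ : Graph (Fin (n * suc k))
  G′ = record
    { Adj    = λ x y → Adj G (to H (f x)) (to H (f y))
    ; symm   = symm G
    ; irrefl = λ { refl → irrefl G refl }
    }

  out : G′ ⊑ G
  out = record { to = to H ∘ f ; injective = f-injective ∘ injective H ; preserves = λ a → a }

  into : n · K (suc k) ⊑ G′
  into = record
    { to        = uncurry combine
    ; injective = λ { {i , j} {i′ , j′} eq → uncurry (cong₂ _,_) (combine-injective i j i′ j′ eq) }
    ; preserves = λ { {i , j} {i′ , j′} e →
        ≡.subst₂ (λ p q → Adj G (to H p) (to H q))
          (sym (remQuot-combine i j)) (sym (remQuot-combine i′ j′)) (preserves H e) }
    }

  Walk : Fin n × Fin (suc k) → Fin n × Fin (suc k) → Set
  Walk p q = Star (Adj G′) (uncurry combine p) (uncurry combine q)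

  edge : ∀ {p q} → Adj G (to H p) (to H q) → Walk p q
  edge {i , j} {i′ , j′} a =
    ≡.subst₂ (λ p q → Adj G (to H p) (to H q))
      (sym (remQuot-combine i j)) (sym (remQuot-combine i′ j′)) a ◅ ε

  toHub : ∀ i j → Walk (i , j) (i , zero)
  toHub i zero    = ε
  toHub i (suc j) = edge (preserves H (refl , λ ()))

  fromHub : ∀ i j → Walk (i , zero) (i , j)
  fromHub i zero    = ε
  fromHub i (suc j) = edge (preserves H (refl , λ ()))

  hubs : ∀ i i′ → Walk (i , zero) (i′ , zero)
  hubs i i′ with i Fin.≟ i′
  ... | yes refl = ε
  ... | no i≢i′  = edge (hub i≢i′)

  -- Go to the hub of the own clique, cross to the other hub, and descend to the target.
  walk : ∀ p q → Walk p q
  walk (i , j) (i′ , j′) = toHub i j ◅◅ hubs i i′ ◅◅ fromHub i′ j′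

  conn : Connected G′
  conn x y = ≡.subst₂ (Star (Adj G′)) (combine-remQuot {n} (suc k) x) (combine-remQuot {n} (suc k) y)
    (walk (f x) (f y))

-- Edge colours and monochromatic cliques.

module _ {N : ℕ} (χ : Colouring N) where

  private
    V = Fin N

  Has : Colour → V → V → Set
  Has x u v = colour χ u v ≡ x

  Has-sym : ∀ {x} → Symmetric (Has x)
  Has-sym {_} {u} {v} = ≡.trans (colour-symm χ v u)

  blue⊎red : ∀ u v → Has blue u v ⊎ Has red u v
  blue⊎red u v with colour χ u v
  ... | red  = inj₂ refl
  ... | blue = inj₁ refl

  Mono : Colour → Vec V k → Set
  Mono x b = AllPairs (Has x) (toList b)

  monoCopy : ∀ {x} (bs : List (Vec V k)) → Unique (flatten bs) → All (Mono x) bs →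
             length bs · K k ⊑ colourClass χ x
  monoCopy bs u ms = record
    { to        = entry bs
    ; injective = entry-injective bs u
    ; preserves = λ { {i , j} {.i , j′} (refl , j≢j′) →
        -- Adjacency in `colourClass` also asks for distinct endpoints, which injectivity of `entry`
        -- supplies.
        (λ eq → j≢j′ (cong proj₂ (entry-injective bs u {i , j} {i , j′} eq))) ,
        AllPairs-vec Has-sym (lookup bs i) (All.lookup ms (∈-lookup i)) j≢j′ }
    }

  -- Packing red triangles around a red clique.

  AlmostRed : List V → V → Set
  AlmostRed U z = ∃[ e ] All (AllBut (Has red z) e) U

  module _ {P : V → Set} (clique : ∀ {u v} → P u → P v → u ≢ v → Has red u v) where

    -- Every triangle keeps its head in `P`, so that the heads can later serve as mutually adjacent
    -- hubs. Surplus vertices go to `rest`.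
    Packing : ℕ → List V → Set
    Packing n xs = ∃₂ λ (ts : List (Vec V 3)) rest →
      length ts ≡ n × All (Mono red) ts × All (P ∘ Vec.head) ts × xs ↭ flatten ts ++ rest

    cliquePacking : ∀ n U → Unique U → All P U → 3 * n ≤ length U → Packing n U
    cliquePacking zero    U u p le = [] , U , refl , [] , [] , ↭-refl
    cliquePacking (suc n) U u p le with subst (_≤ length U) (*-suc 3 n) le
    cliquePacking (suc n) (a ∷ b ∷ d ∷ U)
      ((a≢b ∷ a≢d ∷ _) ∷ (b≢d ∷ _) ∷ _ ∷ u) (pa ∷ pb ∷ pd ∷ p) _ | s≤s (s≤s (s≤s le))
      with cliquePacking n U u p le
    ... | ts , rest , refl , ms , hs , perm =
      (a ∷ b ∷ d ∷ []) ∷ ts , rest , refl ,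
      ((clique pa pb a≢b ∷ clique pa pd a≢d ∷ []) ∷ (clique pb pd b≢d ∷ []) ∷ [] ∷ []) ∷ ms ,
      pa ∷ hs , prep a (prep b (prep d perm))

    -- Each round spends one `z` of `W` and two vertices of `U`. This lowers both sides of the first
    -- inequality by 2 and both sides of the second by 3, so both survive. Once `W` is empty, the
    -- clique alone supplies the remaining triangles.
    packing : ∀ n W U → Unique (W ++ U) → All P U → All (AlmostRed U) W →
              2 * length W < length U → 3 * n ≤ length W + length U → Packing n (W ++ U)
    packing zero    W  U u p as lt le = [] , W ++ U , refl , [] , [] , ↭-refl
    packing (suc n) [] U u p as lt le = cliquePacking (suc n) U u p le
    packing (suc n) (z ∷ W) U u p ((e , az) ∷ as) lt le
      -- The inequality now reads `2 + 2 * length W < length U`, so `U` has at least the three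
      -- vertices that `extractTwo` asks for.
      with U | subst (_< length U) (*-suc 2 (length W)) lt
    ... | _ ∷ []     | s≤s ()
    ... | _ ∷ _ ∷ [] | s≤s (s≤s ())
    ... | U₀@(_ ∷ _ ∷ _ ∷ _) | lt₀
      with extractTwo (proj₂ (proj₂ (AllPairs-++⁻ (z ∷ W) u))) az
    ... | x , y , U′ , perm , zx , zy
      with Unique-resp-↭ (++⁺ˡ (z ∷ W) perm) u | All-resp-↭ perm p | ↭-length perm
    ... | u′ | px ∷ py ∷ p′ | len
      with Unique-resp-↭ moved u′
      where
      moved : z ∷ W ++ x ∷ y ∷ U′ ↭ x ∷ z ∷ y ∷ W ++ U′
      moved = ↭-trans (prep z (shifts W (x ∷ y ∷ [])))
                      (swap z x ↭-refl)
    ... | (_ ∷ x≢y ∷ _) ∷ _ ∷ _ ∷ u″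
      with packing n W U′ u″ p′
             (All.map (λ (e , a) → e , All.tail (All.tail (All-resp-↭ perm a))) as)
             (≤-pred (≤-pred (subst (2 + 2 * length W <_) len lt₀)))
             (+-cancelˡ-≤ 3 _ _ (≡.subst₂ _≤_ (*-suc 3 n) eq le))
      where
      eq : suc (length W) + length U₀ ≡ 3 + (length W + length U′)
      eq = cong suc (≡.trans (cong (length W +_) len)
        (≡.trans (+-suc _ _) (cong suc (+-suc _ _))))
    ... | ts , rest , refl , ms , hs , perm′ =
      -- The clique vertex `x` stands first, because the head has to satisfy `P` and `z` comes from
      -- outside the clique.
      (x ∷ z ∷ y ∷ []) ∷ ts , rest , refl ,
      ((Has-sym zx ∷ clique px py x≢y ∷ []) ∷ (zy ∷ []) ∷ [] ∷ []) ∷ ms , px ∷ hs ,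
      ↭-trans (++⁺ˡ (z ∷ W) perm)
        (↭-trans (prep z (shifts W (x ∷ y ∷ [])))
          (↭-trans (swap z x ↭-refl) (prep x (prep z (prep y perm′)))))

  -- Blue matchings and their augmentation.

  BlueMatching : List (Vec V 2) → List V → Set
  BlueMatching M U = All (Mono blue) M × flatten M ++ U ↭ allFin N

  HasAlmostRed : List V → Vec V 2 → Set
  HasAlmostRed U b = ∃₂ λ z z′ → toList b ↭ z ∷ z′ ∷ [] × AlmostRed U z

  Augmenting : List V → Vec V 2 → Set
  Augmenting U (x ∷ y ∷ []) =
    ∃[ u ] ∃[ v ] ∃[ U′ ] (U ↭ u ∷ v ∷ U′ × Has blue x u × Has blue y v)

  -- If `x` has a blue neighbour `u` in `U`, then either `y` has one among the other vertices,
  -- giving a path of length 3 to augment along, or `y` is red to all of `U` but `u`. Otherwise `x`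
  -- is red to all of `U`.
  augmenting⊎almostRed : ∀ U b → Augmenting U b ⊎ HasAlmostRed U b
  augmenting⊎almostRed U (x ∷ y ∷ []) with extract (blue⊎red x) U
  -- There is no exception here; `x` merely fills the slot.
  ... | inj₂ rs = inj₂ (x , y , ↭-refl , x , All.map inj₂ rs)
  ... | inj₁ (u , U′ , p , xu) with extract (blue⊎red y) U′
  ... | inj₁ (v , U″ , q , yv) = inj₁ (u , v , U″ , ↭-trans p (prep u q) , xu , yv)
  ... | inj₂ rs = inj₂ (y , x , swap x y ↭-refl , u ,
                        All-resp-↭ (↭-sym p) (inj₁ refl ∷ All.map inj₂ rs))

  Stuck : List (Vec V 2) → List V → Set
  Stuck M U = AllPairs (Has red) U × All (HasAlmostRed U) M

  -- A blue edge inside `U` is added to the matching, or else an augmenting edge `x y` is exchanged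
  -- for `x u` and `y v`. If neither is possible, `U` is a red clique.
  improve : ∀ M U → BlueMatching M U →
            (∃₂ λ M′ U′ → length M′ ≡ suc (length M) × BlueMatching M′ U′) ⊎ Stuck M U
  improve M U (bs , p) with extractPair blue⊎red U
  ... | inj₁ (u , v , U′ , q , uv) =
    inj₁ ((u ∷ v ∷ []) ∷ M , U′ , refl , ((uv ∷ []) ∷ [] ∷ []) ∷ bs ,
          ↭-trans (↭-sym (↭-trans (++⁺ˡ (flatten M) q)
            (shifts (flatten M) (u ∷ v ∷ [])))) p)
  ... | inj₂ rs with extract (augmenting⊎almostRed U) M
  ... | inj₂ as = inj₂ (rs , as)
  ... | inj₁ ((x ∷ y ∷ []) , M′ , q , u , v , U′ , r , xu , yv) =
    inj₁ ((x ∷ u ∷ []) ∷ (y ∷ v ∷ []) ∷ M′ , U′ , cong suc (sym (↭-length q)) ,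
          ((xu ∷ []) ∷ [] ∷ []) ∷ ((yv ∷ []) ∷ [] ∷ []) ∷ All.tail (All-resp-↭ q bs) ,
          ↭-trans (↭-sym rearrange) p)
    where
    F = flatten M′
    rearrange : flatten M ++ U ↭ x ∷ u ∷ y ∷ v ∷ F ++ U′
    rearrange = ↭-trans (++⁺ʳ U (flatten-↭ q)) (prep x (↭-trans
      (prep y (↭-trans (++⁺ˡ F r) (shifts F (u ∷ v ∷ []))))
      (swap y u ↭-refl)))

  -- Starting from the empty matching, every application of `improve` gains one edge, so `m` rounds
  -- reach size `m` unless one of them gets stuck earlier.
  matching⊎stuck : ∀ m → (∃₂ λ M U → length M ≡ m × BlueMatching M U)
                         ⊎ (∃₂ λ M U → length M < m × BlueMatching M U × Stuck M U)
  matching⊎stuck zero = inj₁ ([] , allFin N , refl , [] , ↭-refl)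
  matching⊎stuck (suc m) with matching⊎stuck m
  ... | inj₂ (M , U , lt , b , s) = inj₂ (M , U , m<n⇒m<1+n lt , b , s)
  ... | inj₁ (M , U , refl , b) with improve M U b
  ... | inj₁ M⁺ = inj₁ M⁺
  ... | inj₂ s  = inj₂ (M , U , ≤-refl , b , s)

  -- Upper bound: from a stuck matching to connected triangles.

  chooseAlmostRed : ∀ {U} M → All (HasAlmostRed U) M →
    ∃₂ λ W rest → length W ≡ length M × All (AlmostRed U) W × flatten M ↭ W ++ rest
  chooseAlmostRed [] [] = [] , [] , refl , [] , ↭-refl
  chooseAlmostRed (b ∷ M) ((z , z′ , p , a) ∷ as) with chooseAlmostRed M as
  ... | W , rest , len , as′ , q =
    z ∷ W , z′ ∷ rest , cong suc len , a ∷ as′ ,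
    ↭-trans (++⁺ʳ (flatten M) p)
      (prep z (↭-trans (prep z′ q) (↭-sym (shift z′ W rest))))

  -- With `k` matching edges, `W` has `k` vertices and `U` has `N - 2k`. The two numerical
  -- hypotheses then become those of `packing`. The triangle heads lie in the red clique `U`, so
  -- `connectedCopy` applies.
  stuck⇒connectedTriangles : ∀ {n M U} → BlueMatching M U → Stuck M U →
    4 * length M < N → 3 * n + length M ≤ N →
    ∃[ l ] ∃[ G ] (c (n · K 3) {l} G × G ⊑ colourClass χ red)
  stuck⇒connectedTriangles {n} {M} {U} (_ , p) (rs , as) lt le
    with chooseAlmostRed M as
  -- Matched and unmatched vertices together permute `allFin N`, so `W ++ U` inherits its
  -- distinctness from there.
  ... | W , rest , lenW , asW , q
    with AllPairs-++⁻ (W ++ U) (Unique-resp-↭ spread (allFin⁺ N))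
    where
    spread : allFin N ↭ (W ++ U) ++ rest
    spread = ↭-trans (↭-sym p) (↭-trans (++⁺ʳ U q) (↭-trans
      (↭-reflexive (++-assoc W rest U)) (↭-trans (++⁺ˡ W (++-comm rest U))
      (↭-reflexive (sym (++-assoc W U rest))))))
  ... | uniq , _ , _
    with packing {P = _∈ U} (AllPairs-∈ Has-sym rs) n W U uniq (All.tabulate λ x → x) asW lt′ le′
    where
    k′ = length M

    size : 2 * k′ + length U ≡ N
    size = ≡.trans (cong (_+ length U) (sym (length-flatten M)))
      (≡.trans (sym (length-++ (flatten M))) (≡.trans (↭-length p) (length-tabulate λ i → i)))

    open +-*-Solver

    lt′ : 2 * length W < length U
    lt′ rewrite lenW = +-cancelˡ-< (2 * k′) _ _
      (≡.subst₂ _<_ (solve 1 (λ k → con 4 :* k := con 2 :* k :+ con 2 :* k) refl k′) (sym size) lt)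

    le′ : 3 * n ≤ length W + length U
    le′ rewrite lenW = +-cancelʳ-≤ k′ _ _ (≤-trans le (≤-reflexive (≡.trans (sym size)
      (solve 2 (λ k u → con 2 :* k :+ u := k :+ u :+ k) refl k′ (length U)))))
  ... | ts , rest′ , refl , ms , hs , perm
    with AllPairs-++⁻ (flatten ts) (Unique-resp-↭ perm uniq)
  ... | uts , _ , _ = connectedCopy H λ {i} {i′} i≢i′ →
    let ne = λ eq → i≢i′ (cong proj₁ (injective H {i , zero} {i′ , zero} eq))
    in ne , AllPairs-∈ Has-sym rs (hub∈ i) (hub∈ i′) ne
    where
    H = monoCopy ts uts ms

    head≡lookup : (t : Vec V 3) → Vec.head t ≡ Vec.lookup t zero
    head≡lookup (_ ∷ _) = refl

    hub∈ : ∀ i → Vec.lookup (lookup ts i) zero ∈ U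
    hub∈ i = subst (_∈ U) (head≡lookup (lookup ts i)) (All.lookup hs (∈-lookup i))

-- A stuck matching has `k ≤ m` edges, and `m < n` gives `4k ≤ 3m + m < 3n + m`: this leaves two
-- clique vertices for each edge and one more.
upperBound : ∀ m n → suc m ≤ n → Arrows (3 * n + m) (c (n · K 3)) (suc m · K 2)
upperBound m n m<n χ with matching⊎stuck χ (suc m)
... | inj₁ (M , U , len , bs , p) = inj₂ (subst (λ l → l · K 2 ⊑ colourClass χ blue) len
  (monoCopy χ M (proj₁ (AllPairs-++⁻ (flatten M) (Unique-resp-↭ (↭-sym p) (allFin⁺ _)))) bs))
... | inj₂ (M , U , s≤s k≤m , b , s) =
  inj₁ (stuck⇒connectedTriangles χ b s lt (+-monoʳ-≤ (3 * n) k≤m))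
  where
  open ≤-Reasoning
  open +-*-Solver
  lt : 4 * length M < 3 * n + m
  lt = begin-strict
    4 * length M  ≤⟨ *-monoʳ-≤ 4 k≤m ⟩
    4 * m         ≡⟨ solve 1 (λ m → con 4 :* m := con 3 :* m :+ m) refl m ⟩
    3 * m + m     <⟨ +-monoˡ-< m (*-monoʳ-< 3 m<n) ⟩
    3 * n + m     ∎

-- Lower bound: the split colouring.

splitColouring : (m N : ℕ) → Colouring N
splitColouring m N = record { colour = col ; colour-symm = col-symm }
  where
  -- The vertices below `m` meet every blue edge. As `N` is arbitrary, one construction bounds every
  -- `N` that arrows.
  col : Fin N → Fin N → Colour
  col u v with toℕ u <? m | toℕ v <? m
  ... | no _ | no _ = red
  ... | _    | _    = blue

  col-symm : ∀ u v → col u v ≡ col v u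
  col-symm u v with toℕ u <? m | toℕ v <? m
  ... | no _  | no _  = refl
  ... | no _  | yes _ = refl
  ... | yes _ | no _  = refl
  ... | yes _ | yes _ = refl

split-red : ∀ {m N} u v → colour (splitColouring m N) u v ≡ red → m ≤ toℕ u
split-red {m} u v eq with toℕ u <? m | toℕ v <? m
split-red u v eq | no u≮m | no _  = ≮⇒≥ u≮m
split-red u v () | no _   | yes _
split-red u v () | yes _  | no _
split-red u v () | yes _  | yes _

split-blue : ∀ {m N} u v → colour (splitColouring m N) u v ≡ blue → toℕ u < m ⊎ toℕ v < m
split-blue {m} u v eq with toℕ u <? m | toℕ v <? m
split-blue u v () | no _    | no _
split-blue u v eq | yes u<m | _       = inj₁ u<m
split-blue u v eq | no _    | yes v<m = inj₂ v<m

-- Pigeonhole: each of the `suc m` edges has an endpoint among the `m` covering vertices, and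
-- disjoint edges choose different ones.
no-blueMatching : ∀ {m N} → ¬ (suc m · K 2 ⊑ colourClass (splitColouring m N) blue)
no-blueMatching {m} {N} H = 1+n≰n (injective⇒≤ {f = f} f-injective)
  where
  endpoint : ∀ i → ∃[ j ] (toℕ (to H (i , j)) < m)
  endpoint i with split-blue {m} _ _ (proj₂ (preserves H {i , zero} {i , suc zero} (refl , λ ())))
  ... | inj₁ lt = zero , lt
  ... | inj₂ lt = suc zero , lt

  f : Fin (suc m) → Fin m
  f i = fromℕ< (proj₂ (endpoint i))

  f-injective : Injective _≡_ _≡_ f
  f-injective {i} {i′} eq = cong proj₁ (injective H
    {i , proj₁ (endpoint i)} {i′ , proj₁ (endpoint i′)}
    (toℕ-injective (fromℕ<-injective _ _ (proj₂ (endpoint i)) (proj₂ (endpoint i′)) eq)))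

-- Every triangle vertex has a red edge, hence index at least `m`. Subtracting `m` injects the `3n`
-- vertices into `N ∸ m` places.
redTriangles⇒≤ : ∀ {m n N} → 0 < n → n · K 3 ⊑ colourClass (splitColouring m N) red →
                 3 * n + m ≤ N
redTriangles⇒≤ {m} {suc n} {N} _ H =
  m≤o∸n⇒m+n≤o (3 * suc n) m≤N
    (≤-trans (≤-reflexive (*-comm 3 (suc n))) (injective⇒≤ {f = f} f-injective))
  where
  m≤to : ∀ p → m ≤ toℕ (to H p)
  m≤to (i , zero)  =
    split-red {m} _ _ (proj₂ (preserves H {i , zero} {i , suc zero} (refl , λ ())))
  m≤to (i , suc j) =
    split-red {m} _ _ (proj₂ (preserves H {i , suc j} {i , zero} (refl , λ ())))

  -- Since `∸` truncates, `m ≤ N` is required to move `m` across the inequality; a vertex of the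
  -- first triangle witnesses it.
  m≤N : m ≤ N
  m≤N = ≤-trans (m≤to (zero , zero)) (<⇒≤ (toℕ<n (to H (zero , zero))))

  g : Fin (suc n * 3) → Fin N
  g = to H ∘ remQuot 3

  bound : ∀ x → toℕ (g x) ∸ m < N ∸ m
  bound x = ∸-monoˡ-< (toℕ<n (g x)) (m≤to (remQuot 3 x))

  f : Fin (suc n * 3) → Fin (N ∸ m)
  f x = fromℕ< (bound x)

  f-injective : Injective _≡_ _≡_ f
  f-injective {x} {y} eq = ≡.trans (sym (combine-remQuot {suc n} 3 x))
    (≡.trans (cong (uncurry combine) (injective H (toℕ-injective (∸-cancelʳ-≡
      (m≤to (remQuot 3 x)) (m≤to (remQuot 3 y))
      (fromℕ<-injective _ _ (bound x) (bound y) eq)))))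
      (combine-remQuot {suc n} 3 y))

lowerBound : ∀ {m n N} → 0 < n → Arrows N (c (n · K 3)) (suc m · K 2) → 3 * n + m ≤ N
lowerBound {m} {n} {N} 0<n arrows with arrows (splitColouring m N)
... | inj₂ H = contradiction H (no-blueMatching {m})
... | inj₁ (_ , G , (_ , H) , G⊑red) = redTriangles⇒≤ {m} 0<n record
  { to        = to G⊑red ∘ to H
  ; injective = injective H ∘ injective G⊑red
  ; preserves = preserves G⊑red ∘ preserves H
  }

lemma2 : (m n : ℕ) → 1 ≤ m → m ≤ n →
    IsRamseyNumber (c (n · K 3)) (m · K 2) (3 * n + m ∸ 1)
-- The rewrite turns `3 * n + suc m ∸ 1` into `3 * n + m`, the form used by both bounds.
lemma2 (suc m) n _ m<n rewrite +-suc (3 * n) m =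
  m≤n⇒m≤n+o m (≤-trans (s≤s z≤n) (*-monoʳ-≤ 3 0<n)) ,
  upperBound m n m<n ,
  λ N _ → lowerBound 0<n
  where
  0<n : 0 < n
  0<n = ≤-trans (s≤s z≤n) m<n
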